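{- Let $n\in\mathbb{N}$ and $m\in\mathbb{N}_0$. For every nonempty subset $J\subseteq \mathcal{Z}_n$ one has $$\mathcal{H}_m(J)=(-1)^{\{m\}_n}\,\mathcal{E}_{\{m\}_n}(\mathcal{Z}_n\setminus J),$$ where $\{m\}_n$ denotes the remainder of the division of $m$ by $n$.
   Context: $\mathbb{N}=\{1,2,\ldots\}$, $\mathbb{N}_0=\mathbb{N}\cup\{0\}$. $\zeta_n:=e^{2\pi i/n}$ and $\mathcal{Z}_n:=\{1,\zeta_n,\ldots,\zeta_n^{n-1}\}$ is the set of $n$th roots of unity in $\mathbb{C}$. For complex numbers $z_1,\ldots,z_r$ (not necessarily distinct, $r\ge1$) the elementary symmetric polynomials are $\mathcal{E}_0:=1$, $\mathcal{E}_m(z_1,\ldots,z_r):=\sum_{1\le j_1<\cdots<j_m\le r}z_{j_1}\cdots z_{j_m}$ for $1\le m\le r$, and $\mathcal{E}_m:=0$ for $m>r$; the complete homogeneous symmetric polynomials are $\mathcal{H}_0:=1$ and $\mathcal{H}_m(z_1,\ldots,z_r):=\sum_{1\le j_1\le\cdots\le j_m\le r}z_{j_1}\cdots z_{j_m}$ for $m\ge1$. By symmetry, $\mathcal{E}_m(A)$ and $\mathcal{H}_m(A)$ are defined for any finite (multi)set $A=\{z_1,\ldots,z_r\}$ of complex numbers. Convention: $\mathcal{H}_m(\emptyset)=\mathcal{E}_m(\emptyset):=1$ if $m=0$ and $:=0$ otherwise. -}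

module Defs where

open import Algebra.Bundles using (CommutativeRing)
open import Algebra.Structures using (IsCommutativeRing)
open import Data.Fin.Base as Fin using (Fin; toℕ)
import Data.Fin.Properties as Fin
open import Data.Fin.Subset using (Subset)
open import Data.Fin.Subset.Properties using (_∈?_)
open import Data.List.Base as List using (List; [_]; map; filter; foldr; allFin; cartesianProductWith)
open import Data.Nat.Base as ℕ using (ℕ; zero; suc)
import Data.Nat.Properties as ℕ
open import Data.Product.Base using (∃; _×_; _,_; proj₁; proj₂)
open import Data.Rational.Base as ℚ using (ℚ; 0ℚ; 1ℚ; ½; ∣_∣; _<_)
import Data.Rational.Properties as ℚ
open import Data.Rational.Solver using (module +-*-Solver)
open import Data.Vec.Base as Vec using (Vec; []; _∷_)
open import Data.Vec.Relation.Unary.Linked using (Linked; linked?)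
open import Level using (0ℓ)
open import Relation.Binary.PropositionalEquality using (_≡_; refl; sym; trans; cong; subst)
open import Relation.Nullary using (¬_)
open +-*-Solver using (solve; _:=_; _:+_; _:*_; _:-_; :-_; con)

------------------------------------------------------------------------
-- Real numbers

record ℝ : Set where
  no-eta-equality
  field
    seq    : ℕ → ℚ
    cauchy : ∀ ε → 0ℚ < ε → ∃ λ N → ∀ m n → N ℕ.≤ m → N ℕ.≤ n → ∣ seq m ℚ.- seq n ∣ < ε

open ℝ public

infix 4 _≈ᵣ_
infixl 6 _+ᵣ_
infixl 7 _*ᵣ_
infix 8 -ᵣ_

record _≈ᵣ_ (x y : ℝ) : Set where
  constructor mk≈
  field
    close : ∀ ε → 0ℚ < ε → ∃ λ N → ∀ n → N ℕ.≤ n → ∣ seq x n ℚ.- seq y n ∣ < ε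

open _≈ᵣ_ public

-- Doubly indexed null families treat Cauchyness and ≈ᵣ uniformly.
Fam : Set
Fam = ℕ → ℕ → ℚ

Vanishing : Fam → Set
Vanishing s = ∀ ε → 0ℚ < ε → ∃ λ N → ∀ m n → N ℕ.≤ m → N ℕ.≤ n → ∣ s m n ∣ < ε

Bounded : Fam → Set
Bounded b = ∃ λ B → 0ℚ < B × ∃ λ N → ∀ m n → N ℕ.≤ m → N ℕ.≤ n → ∣ b m n ∣ ℚ.≤ B

van-resp : ∀ {s t : Fam} → (∀ m n → s m n ≡ t m n) → Vanishing s → Vanishing t
van-resp eq v ε ε>0 with v ε ε>0
... | N , p = N , λ m n N≤m N≤n → subst (λ q → ∣ q ∣ < ε) (eq m n) (p m n N≤m N≤n)

van-0 : Vanishing (λ _ _ → 0ℚ)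
van-0 ε ε>0 = 0 , λ _ _ _ _ → ε>0

half : ∀ {ε} → 0ℚ < ε → 0ℚ < ½ ℚ.* ε
half {ε} ε>0 = subst (_< ½ ℚ.* ε) (ℚ.*-zeroʳ ½) (ℚ.*-monoʳ-<-pos ½ ε>0)

half+half : ∀ ε → ½ ℚ.* ε ℚ.+ ½ ℚ.* ε ≡ ε
half+half = solve 1 (λ e → con ½ :* e :+ con ½ :* e := e) refl

van-+ : ∀ {s t : Fam} → Vanishing s → Vanishing t → Vanishing (λ m n → s m n ℚ.+ t m n)
van-+ {s} {t} v w ε ε>0 with v (½ ℚ.* ε) (half ε>0) | w (½ ℚ.* ε) (half ε>0)
... | N , p | M , q = N ℕ.⊔ M , λ m n N≤m N≤n →
  ℚ.≤-<-trans (ℚ.∣p+q∣≤∣p∣+∣q∣ (s m n) (t m n))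
    (subst (∣ s m n ∣ ℚ.+ ∣ t m n ∣ <_) (half+half ε)
      (ℚ.+-mono-<
        (p m n (ℕ.≤-trans (ℕ.m≤m⊔n N M) N≤m) (ℕ.≤-trans (ℕ.m≤m⊔n N M) N≤n))
        (q m n (ℕ.≤-trans (ℕ.m≤n⊔m N M) N≤m) (ℕ.≤-trans (ℕ.m≤n⊔m N M) N≤n))))

van-neg : ∀ {s : Fam} → Vanishing s → Vanishing (λ m n → ℚ.- s m n)
van-neg {s} v ε ε>0 with v ε ε>0
... | N , p = N , λ m n N≤m N≤n → subst (_< ε) (sym (ℚ.∣-p∣≡∣p∣ (s m n))) (p m n N≤m N≤n)

scale : ∀ {B ε} → 0ℚ < B → 0ℚ < ε → ∃ λ δ → 0ℚ < δ × B ℚ.* δ ≡ ε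
scale {B} {ε} B>0 ε>0 = 1/B ℚ.* ε , 1/B*ε>0 ,
  trans (sym (ℚ.*-assoc B 1/B ε)) (trans (cong (ℚ._* ε) (ℚ.*-inverseʳ B)) (ℚ.*-identityˡ ε))
  where
  instance
    B-pos : ℚ.Positive B
    B-pos = ℚ.positive B>0
    B-nz : ℚ.NonZero B
    B-nz = ℚ.pos⇒nonZero B
  1/B : ℚ
  1/B = ℚ.1/ B
  instance
    1/B-pos : ℚ.Positive 1/B
    1/B-pos = ℚ.1/pos⇒pos B
  1/B*ε>0 : 0ℚ < 1/B ℚ.* ε
  1/B*ε>0 = subst (_< 1/B ℚ.* ε) (ℚ.*-zeroʳ 1/B) (ℚ.*-monoʳ-<-pos 1/B ε>0)

van-* : ∀ {b s : Fam} → Bounded b → Vanishing s → Vanishing (λ m n → b m n ℚ.* s m n)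
van-* {b} {s} (B , B>0 , M , bnd) v ε ε>0 with scale B>0 ε>0
... | δ , δ>0 , Bδ≡ε with v δ δ>0
...   | N , p = N ℕ.⊔ M , λ m n N≤m N≤n → let
  open ℚ.≤-Reasoning
  instance
    nn : ℚ.NonNegative ∣ s m n ∣
    nn = ℚ.∣-∣-nonNeg (s m n)
    B-pos : ℚ.Positive B
    B-pos = ℚ.positive B>0
  in begin-strict
  ∣ b m n ℚ.* s m n ∣      ≡⟨ ℚ.∣p*q∣≡∣p∣*∣q∣ (b m n) (s m n) ⟩
  ∣ b m n ∣ ℚ.* ∣ s m n ∣  ≤⟨ ℚ.*-monoʳ-≤-nonNeg ∣ s m n ∣
                               (bnd m n (ℕ.≤-trans (ℕ.m≤n⊔m N M) N≤m) (ℕ.≤-trans (ℕ.m≤n⊔m N M) N≤n)) ⟩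
  B ℚ.* ∣ s m n ∣          <⟨ ℚ.*-monoʳ-<-pos B
                               (p m n (ℕ.≤-trans (ℕ.m≤m⊔n N M) N≤m) (ℕ.≤-trans (ℕ.m≤m⊔n N M) N≤n)) ⟩
  B ℚ.* δ                  ≡⟨ Bδ≡ε ⟩
  ε                        ∎

bounded : ∀ x → ∃ λ B → 0ℚ < B × ∃ λ N → ∀ n → N ℕ.≤ n → ∣ seq x n ∣ ℚ.≤ B
bounded x with cauchy x 1ℚ (ℚ.positive⁻¹ 1ℚ)
... | N , p = 1ℚ ℚ.+ ∣ seq x N ∣
    , ℚ.+-mono-<-≤ (ℚ.positive⁻¹ 1ℚ) (ℚ.0≤∣p∣ (seq x N))
    , N , λ n N≤n → let open ℚ.≤-Reasoning in begin
  ∣ seq x n ∣                               ≡⟨ cong ∣_∣ (split (seq x n) (seq x N)) ⟩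
  ∣ (seq x n ℚ.- seq x N) ℚ.+ seq x N ∣     ≤⟨ ℚ.∣p+q∣≤∣p∣+∣q∣ (seq x n ℚ.- seq x N) (seq x N) ⟩
  ∣ seq x n ℚ.- seq x N ∣ ℚ.+ ∣ seq x N ∣   ≤⟨ ℚ.+-monoˡ-≤ ∣ seq x N ∣ (ℚ.<⇒≤ (p n N N≤n ℕ.≤-refl)) ⟩
  1ℚ ℚ.+ ∣ seq x N ∣                        ∎
  where
  split : ∀ a b → a ≡ (a ℚ.- b) ℚ.+ b
  split = solve 2 (λ a b → a := (a :- b) :+ b) refl

boundedˡ : ∀ x → Bounded (λ m _ → seq x m)
boundedˡ x = let B , B>0 , N , p = bounded x in B , B>0 , N , λ m _ N≤m _ → p m N≤m

boundedʳ : ∀ x → Bounded (λ _ n → seq x n)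
boundedʳ x = let B , B>0 , N , p = bounded x in B , B>0 , N , λ _ n _ N≤n → p n N≤n

≈⇒van : ∀ {x y} → x ≈ᵣ y → Vanishing (λ _ n → seq x n ℚ.- seq y n)
≈⇒van e ε ε>0 = let N , p = close e ε ε>0 in N , λ _ n _ N≤n → p n N≤n

van⇒≈ : ∀ {x y} → Vanishing (λ _ n → seq x n ℚ.- seq y n) → x ≈ᵣ y
van⇒≈ v = mk≈ λ ε ε>0 → proj₁ (v ε ε>0) , λ n N≤n → proj₂ (v ε ε>0) n n N≤n N≤n

+-diff : ∀ a b c d → (a ℚ.- c) ℚ.+ (b ℚ.- d) ≡ (a ℚ.+ b) ℚ.- (c ℚ.+ d)
+-diff = solve 4 (λ a b c d → (a :- c) :+ (b :- d) := (a :+ b) :- (c :+ d)) refl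

neg-diff : ∀ a c → ℚ.- (a ℚ.- c) ≡ ℚ.- a ℚ.- ℚ.- c
neg-diff = solve 2 (λ a c → :- (a :- c) := :- a :- :- c) refl

*-diff : ∀ a b c d → a ℚ.* (b ℚ.- d) ℚ.+ d ℚ.* (a ℚ.- c) ≡ a ℚ.* b ℚ.- c ℚ.* d
*-diff = solve 4 (λ a b c d → a :* (b :- d) :+ d :* (a :- c) := a :* b :- c :* d) refl

-- The operations are defined by copatterns, and ℝ and ℂ lack eta, so that
-- unification sees x +ᵣ y rather than its unfolding into rational arithmetic.
fromℚ : ℚ → ℝ
seq    (fromℚ q) _ = q
cauchy (fromℚ q)   = van-resp (λ _ _ → sym (ℚ.+-inverseʳ q)) van-0

0ᵣ 1ᵣ : ℝ
0ᵣ = fromℚ 0ℚ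
1ᵣ = fromℚ 1ℚ

_+ᵣ_ : ℝ → ℝ → ℝ
seq    (x +ᵣ y) n = seq x n ℚ.+ seq y n
cauchy (x +ᵣ y)   =
  van-resp (λ m n → +-diff (seq x m) (seq y m) (seq x n) (seq y n))
    (van-+ (cauchy x) (cauchy y))

-ᵣ_ : ℝ → ℝ
seq    (-ᵣ x) n = ℚ.- seq x n
cauchy (-ᵣ x)   =
  van-resp (λ m n → neg-diff (seq x m) (seq x n)) (van-neg (cauchy x))

_*ᵣ_ : ℝ → ℝ → ℝ
seq    (x *ᵣ y) n = seq x n ℚ.* seq y n
cauchy (x *ᵣ y)   =
  van-resp (λ m n → *-diff (seq x m) (seq y m) (seq x n) (seq y n))
    (van-+ (van-* (boundedˡ x) (cauchy y)) (van-* (boundedʳ y) (cauchy x)))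

pointwise : ∀ {x y} → (∀ n → seq x n ≡ seq y n) → x ≈ᵣ y
pointwise {x} {y} eq = van⇒≈
  (van-resp (λ _ n → sym (trans (cong (ℚ._- seq y n) (eq n)) (ℚ.+-inverseʳ (seq y n)))) van-0)

private
  ≈ᵣ-sym : ∀ {x y} → x ≈ᵣ y → y ≈ᵣ x
  ≈ᵣ-sym {x} {y} e = van⇒≈ (van-resp (λ _ n → swap (seq x n) (seq y n)) (van-neg (≈⇒van e)))
    where
    swap : ∀ a b → ℚ.- (a ℚ.- b) ≡ b ℚ.- a
    swap = solve 2 (λ a b → :- (a :- b) := b :- a) refl

  ≈ᵣ-trans : ∀ {x y z} → x ≈ᵣ y → y ≈ᵣ z → x ≈ᵣ z
  ≈ᵣ-trans {x} {y} {z} e f = van⇒≈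
    (van-resp (λ _ n → tele (seq x n) (seq y n) (seq z n)) (van-+ (≈⇒van e) (≈⇒van f)))
    where
    tele : ∀ a b c → (a ℚ.- b) ℚ.+ (b ℚ.- c) ≡ a ℚ.- c
    tele = solve 3 (λ a b c → (a :- b) :+ (b :- c) := a :- c) refl

  +ᵣ-cong : ∀ {x y u v} → x ≈ᵣ y → u ≈ᵣ v → x +ᵣ u ≈ᵣ y +ᵣ v
  +ᵣ-cong {x} {y} {u} {v} e f = van⇒≈
    (van-resp (λ _ n → +-diff (seq x n) (seq u n) (seq y n) (seq v n)) (van-+ (≈⇒van e) (≈⇒van f)))

  -ᵣ-cong : ∀ {x y} → x ≈ᵣ y → -ᵣ x ≈ᵣ -ᵣ y
  -ᵣ-cong {x} {y} e = van⇒≈ (van-resp (λ _ n → neg-diff (seq x n) (seq y n)) (van-neg (≈⇒van e)))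

  *ᵣ-cong : ∀ {x y u v} → x ≈ᵣ y → u ≈ᵣ v → x *ᵣ u ≈ᵣ y *ᵣ v
  *ᵣ-cong {x} {y} {u} {v} e f = van⇒≈
    (van-resp (λ _ n → *-diff (seq x n) (seq u n) (seq y n) (seq v n))
      (van-+ (van-* (boundedʳ x) (≈⇒van f)) (van-* (boundedʳ v) (≈⇒van e))))

ℝ-isCommutativeRing : IsCommutativeRing _≈ᵣ_ _+ᵣ_ _*ᵣ_ -ᵣ_ 0ᵣ 1ᵣ
ℝ-isCommutativeRing = record
  { isRing = record
    { +-isAbelianGroup = record
      { isGroup = record
        { isMonoid = record
          { isSemigroup = record
            { isMagma = record
              { isEquivalence = record
                { refl  = pointwise λ _ → refl
                ; sym   = ≈ᵣ-sym
                ; trans = ≈ᵣ-trans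
                }
              ; ∙-cong = +ᵣ-cong
              }
            ; assoc = λ x y z → pointwise λ n → ℚ.+-assoc (seq x n) (seq y n) (seq z n)
            }
          ; identity = (λ x → pointwise λ n → ℚ.+-identityˡ (seq x n))
                     , (λ x → pointwise λ n → ℚ.+-identityʳ (seq x n))
          }
        ; inverse = (λ x → pointwise λ n → ℚ.+-inverseˡ (seq x n))
                  , (λ x → pointwise λ n → ℚ.+-inverseʳ (seq x n))
        ; ⁻¹-cong = -ᵣ-cong
        }
      ; comm = λ x y → pointwise λ n → ℚ.+-comm (seq x n) (seq y n)
      }
    ; *-cong = *ᵣ-cong
    ; *-assoc = λ x y z → pointwise λ n → ℚ.*-assoc (seq x n) (seq y n) (seq z n)
    ; *-identity = (λ x → pointwise λ n → ℚ.*-identityˡ (seq x n))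
                 , (λ x → pointwise λ n → ℚ.*-identityʳ (seq x n))
    ; distrib = (λ x y z → pointwise λ n → ℚ.*-distribˡ-+ (seq x n) (seq y n) (seq z n))
              , (λ x y z → pointwise λ n → ℚ.*-distribʳ-+ (seq x n) (seq y n) (seq z n))
    }
  ; *-comm = λ x y → pointwise λ n → ℚ.*-comm (seq x n) (seq y n)
  }

------------------------------------------------------------------------
-- Complex numbers

record ℂ : Set where
  no-eta-equality
  field
    re im : ℝ

open ℂ public

infix 4 _≈_
infixl 6 _+_
infixl 7 _*_
infix 8 -_

record _≈_ (z w : ℂ) : Set where
  constructor _,_
  field
    re-≈ : re z ≈ᵣ re w
    im-≈ : im z ≈ᵣ im w

open _≈_ public

0ℂ 1ℂ : ℂ
re 0ℂ = 0ᵣ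
im 0ℂ = 0ᵣ
re 1ℂ = 1ᵣ
im 1ℂ = 0ᵣ

_+_ _*_ : ℂ → ℂ → ℂ
re (z + w) = re z +ᵣ re w
im (z + w) = im z +ᵣ im w
re (z * w) = re z *ᵣ re w +ᵣ -ᵣ (im z *ᵣ im w)
im (z * w) = re z *ᵣ im w +ᵣ im z *ᵣ re w

-_ : ℂ → ℂ
re (- z) = -ᵣ re z
im (- z) = -ᵣ im z

private
  module R = IsCommutativeRing ℝ-isCommutativeRing

  *-assoc-re : ∀ a b c d e f →
    (a ℚ.* c ℚ.+ ℚ.- (b ℚ.* d)) ℚ.* e ℚ.+ ℚ.- ((a ℚ.* d ℚ.+ b ℚ.* c) ℚ.* f) ≡
    a ℚ.* (c ℚ.* e ℚ.+ ℚ.- (d ℚ.* f)) ℚ.+ ℚ.- (b ℚ.* (c ℚ.* f ℚ.+ d ℚ.* e))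
  *-assoc-re = solve 6 (λ a b c d e f →
    (a :* c :- b :* d) :* e :- (a :* d :+ b :* c) :* f :=
    a :* (c :* e :- d :* f) :- b :* (c :* f :+ d :* e)) refl

  *-assoc-im : ∀ a b c d e f →
    (a ℚ.* c ℚ.+ ℚ.- (b ℚ.* d)) ℚ.* f ℚ.+ (a ℚ.* d ℚ.+ b ℚ.* c) ℚ.* e ≡
    a ℚ.* (c ℚ.* f ℚ.+ d ℚ.* e) ℚ.+ b ℚ.* (c ℚ.* e ℚ.+ ℚ.- (d ℚ.* f))
  *-assoc-im = solve 6 (λ a b c d e f →
    (a :* c :- b :* d) :* f :+ (a :* d :+ b :* c) :* e :=
    a :* (c :* f :+ d :* e) :+ b :* (c :* e :- d :* f)) refl

  distribˡ-re : ∀ a b c d e f →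
    a ℚ.* (c ℚ.+ e) ℚ.+ ℚ.- (b ℚ.* (d ℚ.+ f)) ≡ (a ℚ.* c ℚ.+ ℚ.- (b ℚ.* d)) ℚ.+ (a ℚ.* e ℚ.+ ℚ.- (b ℚ.* f))
  distribˡ-re = solve 6 (λ a b c d e f →
    a :* (c :+ e) :- b :* (d :+ f) := (a :* c :- b :* d) :+ (a :* e :- b :* f)) refl

  distribˡ-im : ∀ a b c d e f →
    a ℚ.* (d ℚ.+ f) ℚ.+ b ℚ.* (c ℚ.+ e) ≡ (a ℚ.* d ℚ.+ b ℚ.* c) ℚ.+ (a ℚ.* f ℚ.+ b ℚ.* e)
  distribˡ-im = solve 6 (λ a b c d e f →
    a :* (d :+ f) :+ b :* (c :+ e) := (a :* d :+ b :* c) :+ (a :* f :+ b :* e)) refl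

  *-comm-re : ∀ a b c d → a ℚ.* c ℚ.+ ℚ.- (b ℚ.* d) ≡ c ℚ.* a ℚ.+ ℚ.- (d ℚ.* b)
  *-comm-re = solve 4 (λ a b c d → a :* c :- b :* d := c :* a :- d :* b) refl

  *-comm-im : ∀ a b c d → a ℚ.* d ℚ.+ b ℚ.* c ≡ c ℚ.* b ℚ.+ d ℚ.* a
  *-comm-im = solve 4 (λ a b c d → a :* d :+ b :* c := c :* b :+ d :* a) refl

  *-identityˡ-re : ∀ a b → 1ℚ ℚ.* a ℚ.+ ℚ.- (0ℚ ℚ.* b) ≡ a
  *-identityˡ-re = solve 2 (λ a b → con 1ℚ :* a :- con 0ℚ :* b := a) refl

  *-identityˡ-im : ∀ a b → 1ℚ ℚ.* b ℚ.+ 0ℚ ℚ.* a ≡ b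
  *-identityˡ-im = solve 2 (λ a b → con 1ℚ :* b :+ con 0ℚ :* a := b) refl

  ≈-trans : ∀ {x y z} → x ≈ y → y ≈ z → x ≈ z
  ≈-trans (p , q) (r , s) = R.trans p r , R.trans q s

  +-cong : ∀ {x y u v} → x ≈ y → u ≈ v → x + u ≈ y + v
  +-cong (p , q) (r , s) = R.+-cong p r , R.+-cong q s

  *-cong : ∀ {x y u v} → x ≈ y → u ≈ v → x * u ≈ y * v
  *-cong (p , q) (r , s) =
    R.+-cong (R.*-cong p r) (R.-‿cong (R.*-cong q s)) , R.+-cong (R.*-cong p s) (R.*-cong q r)

  *-assoc : ∀ x y z → (x * y) * z ≈ x * (y * z)
  *-assoc x y z =
      pointwise (λ n → *-assoc-re (seq (re x) n) (seq (im x) n) (seq (re y) n) (seq (im y) n) (seq (re z) n) (seq (im z) n))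
    , pointwise (λ n → *-assoc-im (seq (re x) n) (seq (im x) n) (seq (re y) n) (seq (im y) n) (seq (re z) n) (seq (im z) n))

  *-comm : ∀ x y → x * y ≈ y * x
  *-comm x y =
      pointwise (λ n → *-comm-re (seq (re x) n) (seq (im x) n) (seq (re y) n) (seq (im y) n))
    , pointwise (λ n → *-comm-im (seq (re x) n) (seq (im x) n) (seq (re y) n) (seq (im y) n))

  *-identityˡ : ∀ x → 1ℂ * x ≈ x
  *-identityˡ x =
      pointwise (λ n → *-identityˡ-re (seq (re x) n) (seq (im x) n))
    , pointwise (λ n → *-identityˡ-im (seq (re x) n) (seq (im x) n))

  distribˡ : ∀ x y z → x * (y + z) ≈ x * y + x * z
  distribˡ x y z =
      pointwise (λ n → distribˡ-re (seq (re x) n) (seq (im x) n) (seq (re y) n) (seq (im y) n) (seq (re z) n) (seq (im z) n))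
    , pointwise (λ n → distribˡ-im (seq (re x) n) (seq (im x) n) (seq (re y) n) (seq (im y) n) (seq (re z) n) (seq (im z) n))

ℂ-commutativeRing : CommutativeRing 0ℓ 0ℓ
ℂ-commutativeRing = record
  { Carrier = ℂ
  ; _≈_ = _≈_
  ; _+_ = _+_
  ; _*_ = _*_
  ; -_  = -_
  ; 0#  = 0ℂ
  ; 1#  = 1ℂ
  ; isCommutativeRing = record
    { isRing = record
      { +-isAbelianGroup = record
        { isGroup = record
          { isMonoid = record
            { isSemigroup = record
              { isMagma = record
                { isEquivalence = record
                  { refl  = R.refl , R.refl
                  ; sym   = λ e → R.sym (re-≈ e) , R.sym (im-≈ e)
                  ; trans = ≈-trans
                  }
                ; ∙-cong = +-cong
                }
              ; assoc = λ x y z → R.+-assoc (re x) (re y) (re z) , R.+-assoc (im x) (im y) (im z)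
              }
            ; identity = (λ x → R.+-identityˡ (re x) , R.+-identityˡ (im x))
                       , (λ x → R.+-identityʳ (re x) , R.+-identityʳ (im x))
            }
          ; inverse = (λ x → R.-‿inverseˡ (re x) , R.-‿inverseˡ (im x))
                    , (λ x → R.-‿inverseʳ (re x) , R.-‿inverseʳ (im x))
          ; ⁻¹-cong = λ e → R.-‿cong (re-≈ e) , R.-‿cong (im-≈ e)
          }
        ; comm = λ x y → R.+-comm (re x) (re y) , R.+-comm (im x) (im y)
        }
      ; *-cong = *-cong
      ; *-assoc = *-assoc
      ; *-identity = *-identityˡ , λ x → ≈-trans (*-comm x 1ℂ) (*-identityˡ x)
      ; distrib = distribˡ
                , λ x y z → ≈-trans (*-comm (y + z) x)
                    (≈-trans (distribˡ x y z) (+-cong (*-comm x y) (*-comm x z)))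
      }
    ; *-comm = *-comm
    }
  }

open import Algebra.Properties.Semiring.Exp (CommutativeRing.semiring ℂ-commutativeRing)
  using (_^_) public

------------------------------------------------------------------------
-- Symmetric polynomials

sum product : List ℂ → ℂ
sum     = foldr _+_ 0ℂ
product = foldr _*_ 1ℂ

tuples : ∀ r m → List (Vec (Fin r) m)
tuples r zero    = [ [] ]
tuples r (suc m) = cartesianProductWith _∷_ (allFin r) (tuples r m)

monomial : ∀ {m} (zs : List ℂ) → Vec (Fin (List.length zs)) m → ℂ
monomial zs js = product (map (List.lookup zs) (Vec.toList js))

-- The conventions 𝓔₀ = 𝓗₀ = 1, 𝓔ₘ = 0 for m > r and those for the empty
-- multiset need no separate clauses: there is one tuple of length 0, no
-- strictly increasing m-tuple below r when m > r, and no m-tuple at all when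
-- r = 0 < m.
𝓔 𝓗 : ℕ → List ℂ → ℂ
𝓔 m zs = sum (map (monomial zs) (filter (linked? Fin._<?_) (tuples (List.length zs) m)))
𝓗 m zs = sum (map (monomial zs) (filter (linked? Fin._≤?_) (tuples (List.length zs) m)))

------------------------------------------------------------------------
-- Roots of unity

record PrimitiveRoot (n : ℕ) (ζ : ℂ) : Set where
  field
    isRoot    : ζ ^ n ≈ 1ℂ
    notBefore : ∀ k → 0 ℕ.< k → k ℕ.< n → ¬ ζ ^ k ≈ 1ℂ

-- A subset of 𝒵ₙ = {1, ζ, …, ζⁿ⁻¹} is given by its set of exponents.  For ζ
-- primitive these powers are pairwise distinct, so nothing is listed twice and
-- complements of exponent sets are complements of sets of roots.  One such ζ is
-- e^(2πi/n), and 𝒵ₙ is the set of n-th roots of unity whichever is chosen.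
powers : ∀ {n} → ℂ → Subset n → List ℂ
powers {n} ζ J = map (λ i → ζ ^ toℕ i) (filter (_∈? J) (allFin n))

module Submission where

-- With h = ∑ₘ 𝓗ₘ(J) tᵐ and c = ∏_{z ∉ J} (1 − z t) = ∑ₘ (−1)ᵐ 𝓔ₘ(𝒵ₙ ∖ J) tᵐ, both
-- (1 − tⁿ) h and c become 1 − tⁿ after multiplication by ∏_{z ∈ J} (1 − z t), so
-- they are equal.  As J is nonempty, c has degree below n; hence h has period n and
-- agrees with c in degrees below n.
--
-- That ∏_{z ∈ 𝒵ₙ} (1 − z t) = 1 − tⁿ follows from its invariance under t ↦ ζ t: the
-- coefficient of tᵐ is fixed by multiplication by ζᵐ, hence vanishes for 0 < m < n,
-- and the top coefficient is determined by the root t = 1.  Constructively, ζᵐ ≉ 1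
-- does not make ζᵐ − 1 invertible, but it still cancels from z w ≈ 0.

open import Defs
open import Data.Nat.Base using (ℕ; NonZero)
open import Data.Nat.DivMod using (_%_)
open import Data.Fin.Subset using (Subset; Nonempty; ∁)

open import Algebra.Bundles using (CommutativeRing)
import Algebra.Properties.AbelianGroup
import Algebra.Properties.Group
import Algebra.Properties.Ring
import Algebra.Solver.Ring.NaturalCoefficients.Default
open import Data.Bool.Base using (true; false; if_then_else_)
open import Data.Fin.Base as Fin using (Fin; zero; suc; toℕ)
import Data.Fin.Properties as Fin
open import Data.Fin.Subset.Properties using (_∈?_; x∈p⇒x∉∁p; x∉p⇒x∈∁p)
open import Data.List.Base using (List; []; _∷_; _++_; map; foldr; filter; length; lookup; tabulate; allFin; applyUpTo; cartesianProductWith)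
open import Data.List.Membership.Propositional.Properties using (∈-allFin)
open import Data.List.Properties using (map-++; map-∘; map-tabulate; map-applyUpTo; length-applyUpTo; length-map; length-tabulate; filter-notAll)
import Data.List.Relation.Unary.Any as Any
open import Data.Nat.Base as ℕ using (zero; suc)
open import Data.Nat.DivMod using (_/_; m≡m%n+[m/n]*n; m%n<n)
import Data.Nat.Properties as ℕ
open import Data.Product.Base using (∃; _×_; _,_; proj₁; proj₂)
open import Data.Rational.Base as ℚ using (ℚ; 0ℚ; ½; ∣_∣; _<_; _≤_)
import Data.Rational.Properties as ℚ
open import Data.Rational.Solver using (module +-*-Solver)
open import Data.Sum.Base using (inj₁; inj₂)
open import Data.Vec.Base using (Vec; []; _∷_)
open import Data.Vec.Relation.Unary.Linked using (linked?)
open import Function.Base using (_∘_; id)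
open import Level using (Level; 0ℓ)
open import Relation.Binary.Core using (Rel)
open import Relation.Binary.Definitions using (Decidable; tri<; tri≈; tri>)
open import Relation.Binary.PropositionalEquality using (_≡_; refl; sym; trans; cong; cong₂; subst; subst₂)
import Relation.Binary.Reasoning.Setoid
open import Relation.Nullary using (¬_; yes; no; does; contradiction)
import Relation.Unary as Unary

ℝ-commutativeRing : CommutativeRing 0ℓ 0ℓ
ℝ-commutativeRing = record { isCommutativeRing = ℝ-isCommutativeRing }

module R = CommutativeRing ℝ-commutativeRing
module C = CommutativeRing ℂ-commutativeRing

open Algebra.Properties.AbelianGroup C.+-abelianGroup using (⁻¹-∙-comm)
open Algebra.Properties.Group C.+-group using (∙-cancelʳ; ε⁻¹≈ε; x∙y⁻¹≈ε⇒x≈y)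
open Algebra.Properties.Ring C.ring using (-‿distribʳ-*; -1*x≈-x)

private variable
  a p : Level
  A B D : Set a

-- Polynomial identities over ℚ.

module _ where
  open +-*-Solver

  p-q+q≡p : ∀ p q → (p ℚ.- q) ℚ.+ q ≡ p
  p-q+q≡p = solve 2 (λ p q → (p :- q) :+ q := p) refl

  -p*-p≡p*p : ∀ p → ℚ.- p ℚ.* ℚ.- p ≡ p ℚ.* p
  -p*-p≡p*p = solve 1 (λ p → :- p :* :- p := p :* p) refl

  -- With z = a + b i and w = c + d i, this is the real part of conj z (z w) = |z|² w, in the form
  -- to which `_*_` unfolds on terms of the sequences; `conj-*-*-im` is the imaginary part.
  conj-*-*-re : ∀ a b c d →
    a ℚ.* (a ℚ.* c ℚ.+ ℚ.- (b ℚ.* d)) ℚ.+ ℚ.- (ℚ.- b ℚ.* (a ℚ.* d ℚ.+ b ℚ.* c)) ≡ (a ℚ.* a ℚ.+ b ℚ.* b) ℚ.* c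
  conj-*-*-re = solve 4 (λ a b c d →
    a :* (a :* c :- b :* d) :- (:- b) :* (a :* d :+ b :* c) := (a :* a :+ b :* b) :* c) refl

  conj-*-*-im : ∀ a b c d →
    a ℚ.* (a ℚ.* d ℚ.+ b ℚ.* c) ℚ.+ ℚ.- b ℚ.* (a ℚ.* c ℚ.+ ℚ.- (b ℚ.* d)) ≡ (a ℚ.* a ℚ.+ b ℚ.* b) ℚ.* d
  conj-*-*-im = solve 4 (λ a b c d →
    a :* (a :* d :+ b :* c) :+ (:- b) :* (a :* c :- b :* d) := (a :* a :+ b :* b) :* d) refl

-- Zero products in ℂ

small⇒≈0 : ∀ {x} → (∀ ε → 0ℚ < ε → ∃ λ N → ∀ n → N ℕ.≤ n → ∣ seq x n ∣ < ε) → x ≈ᵣ 0ᵣ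
small⇒≈0 {x} s = mk≈ λ ε ε>0 → let N , p = s ε ε>0 in
  N , λ n N≤n → subst (λ q → ∣ q ∣ < ε) (sym (ℚ.+-identityʳ (seq x n))) (p n N≤n)

≈0⇒small : ∀ {x} → x ≈ᵣ 0ᵣ → ∀ ε → 0ℚ < ε → ∃ λ N → ∀ n → N ℕ.≤ n → ∣ seq x n ∣ < ε
≈0⇒small {x} e ε ε>0 = let N , p = close e ε ε>0 in
  N , λ n N≤n → subst (λ q → ∣ q ∣ < ε) (ℚ.+-identityʳ (seq x n)) (p n N≤n)

*-mono-≤-nonNeg : ∀ {p q r s} → 0ℚ ≤ p → 0ℚ ≤ s → p ≤ q → r ≤ s → p ℚ.* r ≤ q ℚ.* s
*-mono-≤-nonNeg {p} {q} {r} {s} 0≤p 0≤s p≤q r≤s = ℚ.≤-trans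
  (ℚ.*-monoˡ-≤-nonNeg p {{ℚ.nonNegative 0≤p}} r≤s)
  (ℚ.*-monoʳ-≤-nonNeg s {{ℚ.nonNegative 0≤s}} p≤q)

*-pos : ∀ {p q} → 0ℚ < p → 0ℚ < q → 0ℚ < p ℚ.* q
*-pos {p} {q} 0<p 0<q =
  subst (_< p ℚ.* q) (ℚ.*-zeroʳ p) (ℚ.*-monoʳ-<-pos p {{ℚ.positive 0<p}} 0<q)

∣p∣²≡p² : ∀ p → ∣ p ∣ ℚ.* ∣ p ∣ ≡ p ℚ.* p
∣p∣²≡p² p with ℚ.∣p∣≡p∨∣p∣≡-p p
... | inj₁ eq = cong₂ ℚ._*_ eq eq
... | inj₂ eq = trans (cong₂ ℚ._*_ eq eq) (-p*-p≡p*p p)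

-- If y had a term of absolute value at least ε/2 beyond its ε/4-Cauchy index, it
-- would be bounded away from 0, which would force x ≈ᵣ 0ᵣ.
ℝ-zero-product : ∀ {x y} → x *ᵣ y ≈ᵣ 0ᵣ → ¬ x ≈ᵣ 0ᵣ → y ≈ᵣ 0ᵣ
ℝ-zero-product {x} {y} xy≈0 x≉0 = small⇒≈0 small
  where
  triangle : ∀ a b → ∣ a ∣ ≤ ∣ a ℚ.- b ∣ ℚ.+ ∣ b ∣
  triangle a b = subst (λ q → ∣ q ∣ ≤ ∣ a ℚ.- b ∣ ℚ.+ ∣ b ∣) (p-q+q≡p a b)
    (ℚ.∣p+q∣≤∣p∣+∣q∣ (a ℚ.- b) b)

  small : ∀ ε → 0ℚ < ε → ∃ λ N → ∀ n → N ℕ.≤ n → ∣ seq y n ∣ < ε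
  small ε ε>0 with cauchy y (½ ℚ.* (½ ℚ.* ε)) (half (half ε>0))
  -- What is compared with ε/2 is a single rational term, so the case distinction is decidable.
  ... | N , c with ∣ seq y N ∣ ℚ.<? ½ ℚ.* ε
  ...   | yes yN<ε/2 = N , λ n N≤n → let open ℚ.≤-Reasoning in begin-strict
    ∣ seq y n ∣                              ≤⟨ triangle (seq y n) (seq y N) ⟩
    ∣ seq y n ℚ.- seq y N ∣ ℚ.+ ∣ seq y N ∣  <⟨ ℚ.+-mono-< (c n N N≤n ℕ.≤-refl) yN<ε/2 ⟩
    ½ ℚ.* (½ ℚ.* ε) ℚ.+ ½ ℚ.* ε              <⟨ ℚ.+-monoˡ-< (½ ℚ.* ε) quarter<half ⟩
    ½ ℚ.* ε ℚ.+ ½ ℚ.* ε                      ≡⟨ half+half ε ⟩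
    ε                                        ∎
    where
    quarter<half : ½ ℚ.* (½ ℚ.* ε) < ½ ℚ.* ε
    quarter<half = let δ = ½ ℚ.* (½ ℚ.* ε) in subst (δ <_) (half+half (½ ℚ.* ε))
      (subst (_< δ ℚ.+ δ) (ℚ.+-identityʳ δ) (ℚ.+-monoʳ-< δ (half (half ε>0))))
  ...   | no yN≮ε/2 = contradiction (small⇒≈0 x-small) x≉0
    where
    δ : ℚ
    δ = ½ ℚ.* (½ ℚ.* ε)

    δ≤∣y∣ : ∀ n → N ℕ.≤ n → δ ≤ ∣ seq y n ∣
    δ≤∣y∣ n N≤n = ℚ.≮⇒≥ λ y<δ → yN≮ε/2 (let open ℚ.≤-Reasoning in begin-strict
      ∣ seq y N ∣                              ≤⟨ triangle (seq y N) (seq y n) ⟩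
      ∣ seq y N ℚ.- seq y n ∣ ℚ.+ ∣ seq y n ∣  <⟨ ℚ.+-mono-< (c N n ℕ.≤-refl N≤n) y<δ ⟩
      δ ℚ.+ δ                                  ≡⟨ half+half (½ ℚ.* ε) ⟩
      ½ ℚ.* ε                                  ∎)

    x-small : ∀ η → 0ℚ < η → ∃ λ M → ∀ n → M ℕ.≤ n → ∣ seq x n ∣ < η
    -- Beyond `N` one has |y| ≥ δ, so |x| ≥ η would force |x y| ≥ η δ; this fixes the precision
    -- asked of the product.
    x-small η η>0 with ≈0⇒small xy≈0 (η ℚ.* δ) (*-pos η>0 (half (half ε>0)))
    ... | M , p = N ℕ.⊔ M , λ n N⊔M≤n → ℚ.≰⇒> λ η≤x →
      ℚ.<-irrefl refl (let open ℚ.≤-Reasoning in begin-strict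
        η ℚ.* δ                    ≤⟨ *-mono-≤-nonNeg (ℚ.<⇒≤ η>0) (ℚ.0≤∣p∣ (seq y n)) η≤x
                                        (δ≤∣y∣ n (ℕ.≤-trans (ℕ.m≤m⊔n N M) N⊔M≤n)) ⟩
        ∣ seq x n ∣ ℚ.* ∣ seq y n ∣  ≡⟨ ℚ.∣p*q∣≡∣p∣*∣q∣ (seq x n) (seq y n) ⟨
        ∣ seq x n ℚ.* seq y n ∣    <⟨ p n (ℕ.≤-trans (ℕ.m≤n⊔m N M) N⊔M≤n) ⟩
        η ℚ.* δ                    ∎)

-- As y² ≥ 0, a term |x| ≥ ε would give x² + y² ≥ ε²; hence the precision ε².
x²+y²≈0⇒x≈0 : ∀ {x y} → x *ᵣ x +ᵣ y *ᵣ y ≈ᵣ 0ᵣ → x ≈ᵣ 0ᵣ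
x²+y²≈0⇒x≈0 {x} {y} e = small⇒≈0 λ ε ε>0 → let N , p = ≈0⇒small e (ε ℚ.* ε) (*-pos ε>0 ε>0) in
  N , λ n N≤n → ℚ.≰⇒> λ ε≤x → let a = seq x n ; b = seq y n in
  ℚ.<-irrefl refl (let open ℚ.≤-Reasoning in begin-strict
    ε ℚ.* ε                  ≤⟨ *-mono-≤-nonNeg (ℚ.<⇒≤ ε>0) (ℚ.0≤∣p∣ a) ε≤x ε≤x ⟩
    ∣ a ∣ ℚ.* ∣ a ∣          ≡⟨ ∣p∣²≡p² a ⟩
    a ℚ.* a                  ≡⟨ ℚ.+-identityʳ (a ℚ.* a) ⟨
    a ℚ.* a ℚ.+ 0ℚ           ≤⟨ ℚ.+-monoʳ-≤ (a ℚ.* a) (0≤p² b) ⟩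
    a ℚ.* a ℚ.+ b ℚ.* b      ≤⟨ p≤∣p∣ (a ℚ.* a ℚ.+ b ℚ.* b) ⟩
    ∣ a ℚ.* a ℚ.+ b ℚ.* b ∣  <⟨ p n N≤n ⟩
    ε ℚ.* ε                  ∎)
  where
  0≤p² : ∀ p → 0ℚ ≤ p ℚ.* p
  0≤p² p = subst (0ℚ ≤_) (∣p∣²≡p² p)
    (*-mono-≤-nonNeg ℚ.≤-refl (ℚ.0≤∣p∣ p) (ℚ.0≤∣p∣ p) (ℚ.0≤∣p∣ p))

  p≤∣p∣ : ∀ p → p ≤ ∣ p ∣
  p≤∣p∣ p with ℚ.≤-total 0ℚ p
  ... | inj₁ 0≤p = ℚ.≤-reflexive (sym (ℚ.0≤p⇒∣p∣≡p 0≤p))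
  ... | inj₂ p≤0 = ℚ.≤-trans p≤0 (ℚ.0≤∣p∣ p)

conj : ℂ → ℂ
re (conj z) = re z
im (conj z) = -ᵣ im z

norm² : ℂ → ℝ
norm² z = re z *ᵣ re z +ᵣ im z *ᵣ im z

norm²≈0⇒≈0 : ∀ {z} → norm² z ≈ᵣ 0ᵣ → z ≈ 0ℂ
norm²≈0⇒≈0 e = x²+y²≈0⇒x≈0 e , x²+y²≈0⇒x≈0 (R.trans (R.+-comm _ _) e)

conj-*-* : ∀ z w → let v = conj z * (z * w) in
           (re v ≈ᵣ norm² z *ᵣ re w) × (im v ≈ᵣ norm² z *ᵣ im w)
conj-*-* z w =
    pointwise (λ n → conj-*-*-re (seq (re z) n) (seq (im z) n) (seq (re w) n) (seq (im w) n))
  , pointwise (λ n → conj-*-*-im (seq (re z) n) (seq (im z) n) (seq (re w) n) (seq (im w) n))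

-- Multiplication by `conj z` turns the product into `norm² z` times each component of `w`, and the
-- real case applies to both.
ℂ-zero-product : ∀ {z w} → z * w ≈ 0ℂ → ¬ z ≈ 0ℂ → w ≈ 0ℂ
ℂ-zero-product {z} {w} zw≈0 z≉0 =
    ℝ-zero-product (R.trans (R.sym re-eq) (re-≈ v≈0)) norm²≉0
  , ℝ-zero-product (R.trans (R.sym im-eq) (im-≈ v≈0)) norm²≉0
  where
  re-eq = proj₁ (conj-*-* z w)
  im-eq = proj₂ (conj-*-* z w)
  v≈0 : conj z * (z * w) ≈ 0ℂ
  v≈0 = C.trans (C.*-cong (C.refl {conj z}) zw≈0) (C.zeroʳ (conj z))
  norm²≉0 : ¬ norm² z ≈ᵣ 0ᵣ
  norm²≉0 e = z≉0 (norm²≈0⇒≈0 e)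

-- 𝓔 and 𝓗 by recursion over the list

module Solver = Algebra.Solver.Ring.NaturalCoefficients.Default C.commutativeSemiring
open Solver using (_:=_; _:+_; _:*_)
open Relation.Binary.Reasoning.Setoid C.setoid

sum-map-cong : ∀ {f g : A → ℂ} → (∀ x → f x ≈ g x) → ∀ xs → sum (map f xs) ≈ sum (map g xs)
sum-map-cong f≈g []       = C.refl
sum-map-cong f≈g (x ∷ xs) = C.+-cong (f≈g x) (sum-map-cong f≈g xs)

sum-map-0 : ∀ (xs : List A) → sum (map (λ _ → 0ℂ) xs) ≈ 0ℂ
sum-map-0 []       = C.refl
sum-map-0 (x ∷ xs) = C.trans (C.+-identityˡ _) (sum-map-0 xs)

sum-++ : ∀ xs ys → sum (xs ++ ys) ≈ sum xs + sum ys
sum-++ []       ys = C.sym (C.+-identityˡ (sum ys))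
sum-++ (x ∷ xs) ys = C.trans (C.+-congˡ (sum-++ xs ys)) (C.sym (C.+-assoc x (sum xs) (sum ys)))

sum-map-* : ∀ z (f : A → ℂ) xs → sum (map (λ x → z * f x) xs) ≈ z * sum (map f xs)
sum-map-* z f []       = C.sym (C.zeroʳ z)
sum-map-* z f (x ∷ xs) = C.trans (C.+-congˡ (sum-map-* z f xs)) (C.sym (C.distribˡ z (f x) (sum (map f xs))))

sum-map-filter : ∀ {P : Unary.Pred A p} (P? : Unary.Decidable P) (f : A → ℂ) xs →
  sum (map f (filter P? xs)) ≈ sum (map (λ x → if does (P? x) then f x else 0ℂ) xs)
sum-map-filter P? f []       = C.refl
sum-map-filter P? f (x ∷ xs) with does (P? x)
... | true  = C.+-congˡ (sum-map-filter P? f xs)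
... | false = C.trans (sum-map-filter P? f xs) (C.sym (C.+-identityˡ _))

sum-map-cartesianProductWith : ∀ (f : D → ℂ) (g : A → B → D) xs ys →
  sum (map f (cartesianProductWith g xs ys)) ≈ sum (map (λ x → sum (map (λ y → f (g x y)) ys)) xs)
sum-map-cartesianProductWith f g []       ys = C.refl
sum-map-cartesianProductWith f g (x ∷ xs) ys = begin
  sum (map f (map (g x) ys ++ gs))              ≡⟨ cong sum (map-++ f (map (g x) ys) gs) ⟩
  sum (map f (map (g x) ys) ++ map f gs)        ≈⟨ sum-++ (map f (map (g x) ys)) (map f gs) ⟩
  sum (map f (map (g x) ys)) + sum (map f gs)
    ≈⟨ C.+-cong (C.reflexive (cong sum (sym (map-∘ ys)))) (sum-map-cartesianProductWith f g xs ys) ⟩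
  sum (map (f ∘ g x) ys) + sum (map (λ x → sum (map (λ y → f (g x y)) ys)) xs) ∎
  where gs = cartesianProductWith g xs ys

sum-tabulate-cong : ∀ {n} {f g : Fin n → ℂ} → (∀ i → f i ≈ g i) → sum (tabulate f) ≈ sum (tabulate g)
sum-tabulate-cong {zero}  f≈g = C.refl
sum-tabulate-cong {suc n} f≈g = C.+-cong (f≈g zero) (sum-tabulate-cong (f≈g ∘ suc))

-- Instantiated with < for 𝓔 and with ≤ for 𝓗.
module LinkedSum {ℓ} {_≺_ : ∀ {r} → Rel (Fin r) ℓ} (_≺?_ : ∀ {r} → Decidable (_≺_ {r}))
  (suc≺?suc  : ∀ {r} (i j : Fin r) → does (suc i ≺? suc j) ≡ does (i ≺? j))
  (suc≺?zero : ∀ {r} (i : Fin r) → does (suc i ≺? zero) ≡ false) where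

  linkedSum : ℕ → List ℂ → ℂ
  linkedSum m zs = sum (map (monomial zs) (filter (linked? _≺?_) (tuples (length zs) m)))

  -- The sum over the m-tuples that continue a linked tuple ending in i.
  linkedSumAfter : ∀ (m : ℕ) (zs : List ℂ) → Fin (length zs) → ℂ
  linkedSumAfter zero    zs i = 1ℂ
  linkedSumAfter (suc m) zs i =
    sum (tabulate λ j → if does (i ≺? j) then lookup zs j * linkedSumAfter m zs j else 0ℂ)

  private
    linkedTerm : ∀ (zs : List ℂ) {m} → Vec (Fin (length zs)) m → ℂ
    linkedTerm zs js = if does (linked? _≺?_ js) then monomial zs js else 0ℂ

    -- The index `i` is tested but its entry is not multiplied in: this is what remains of the term
    -- of `i ∷ js` once the factor of `i` is pulled out.
    guardedTerm : ∀ (zs : List ℂ) {m} → Fin (length zs) → Vec (Fin (length zs)) m → ℂ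
    guardedTerm zs i js = if does (linked? _≺?_ (i ∷ js)) then monomial zs js else 0ℂ

    tuples-∷ : ∀ (zs : List ℂ) m (f : Vec (Fin (length zs)) (suc m) → ℂ) →
      sum (map f (tuples (length zs) (suc m))) ≈
      sum (tabulate λ j → sum (map (λ js → f (j ∷ js)) (tuples (length zs) m)))
    tuples-∷ zs m f = C.trans
      (sum-map-cartesianProductWith f _∷_ (allFin (length zs)) (tuples (length zs) m))
      (C.reflexive (cong sum (map-tabulate id (λ j → sum (map (λ js → f (j ∷ js)) (tuples (length zs) m))))))

    linkedTerm-∷ : ∀ zs m j → sum (map (λ js → linkedTerm zs (j ∷ js)) (tuples (length zs) m)) ≈
      lookup zs j * sum (map (guardedTerm zs j) (tuples (length zs) m))
    linkedTerm-∷ zs m j = C.trans (sum-map-cong pull (tuples (length zs) m))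
      (sum-map-* (lookup zs j) (guardedTerm zs j) (tuples (length zs) m))
      where
      pull : ∀ js → linkedTerm zs (j ∷ js) ≈ lookup zs j * guardedTerm zs j js
      pull js with does (linked? _≺?_ (j ∷ js))
      ... | true  = C.refl
      ... | false = C.sym (C.zeroʳ (lookup zs j))

    -- The decision for `i ∷ j ∷ js` computes to a conjunction: if `i ≺? j` succeeds, only the
    -- condition on `j ∷ js` is left; otherwise every term is 0.
    guardedTerm-∷ : ∀ zs m i j → sum (map (λ js → guardedTerm zs i (j ∷ js)) (tuples (length zs) m)) ≈
      (if does (i ≺? j) then lookup zs j * sum (map (guardedTerm zs j) (tuples (length zs) m)) else 0ℂ)
    guardedTerm-∷ zs m i j with does (i ≺? j)
    ... | true  = linkedTerm-∷ zs m j
    ... | false = sum-map-0 (tuples (length zs) m)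

    linkedSumAfter-correct : ∀ m zs i → sum (map (guardedTerm zs i) (tuples (length zs) m)) ≈ linkedSumAfter m zs i
    linkedSumAfter-correct zero    zs i = C.+-identityʳ 1ℂ
    linkedSumAfter-correct (suc m) zs i = C.trans (tuples-∷ zs m (guardedTerm zs i))
      (sum-tabulate-cong λ j → C.trans (guardedTerm-∷ zs m i j) (weaken j))
      where
      weaken : ∀ j →
        (if does (i ≺? j) then lookup zs j * sum (map (guardedTerm zs j) (tuples (length zs) m)) else 0ℂ) ≈
        (if does (i ≺? j) then lookup zs j * linkedSumAfter m zs j else 0ℂ)
      weaken j with does (i ≺? j)
      ... | true  = C.*-congˡ (linkedSumAfter-correct m zs j)
      ... | false = C.refl

  linkedSum-zero : ∀ zs → linkedSum zero zs ≈ 1ℂ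
  linkedSum-zero zs = C.+-identityʳ 1ℂ

  linkedSum-suc : ∀ m zs → linkedSum (suc m) zs ≈ sum (tabulate λ j → lookup zs j * linkedSumAfter m zs j)
  linkedSum-suc m zs = begin
    linkedSum (suc m) zs
      ≈⟨ sum-map-filter (linked? _≺?_) (monomial zs) (tuples (length zs) (suc m)) ⟩
    sum (map (linkedTerm zs) (tuples (length zs) (suc m)))
      ≈⟨ tuples-∷ zs m (linkedTerm zs) ⟩
    sum (tabulate λ j → sum (map (λ js → linkedTerm zs (j ∷ js)) (tuples (length zs) m)))
      ≈⟨ sum-tabulate-cong (λ j → C.trans (linkedTerm-∷ zs m j) (C.*-congˡ (linkedSumAfter-correct m zs j))) ⟩
    sum (tabulate λ j → lookup zs j * linkedSumAfter m zs j) ∎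

  -- By `suc≺?zero` the head never follows a later index, and by `suc≺?suc` the later indices are
  -- related as they are in `zs`.
  linkedSumAfter-suc : ∀ m z zs i → linkedSumAfter m (z ∷ zs) (suc i) ≈ linkedSumAfter m zs i
  linkedSumAfter-suc zero    z zs i = C.refl
  linkedSumAfter-suc (suc m) z zs i rewrite suc≺?zero i =
    C.trans (C.+-identityˡ _) (sum-tabulate-cong step)
    where
    step : ∀ j →
      (if does (suc i ≺? suc j) then lookup zs j * linkedSumAfter m (z ∷ zs) (suc j) else 0ℂ) ≈
      (if does (i ≺? j) then lookup zs j * linkedSumAfter m zs j else 0ℂ)
    step j rewrite suc≺?suc i j with does (i ≺? j)
    ... | true  = C.*-congˡ (linkedSumAfter-suc m z zs j)
    ... | false = C.refl

  linkedSum-tail : ∀ m z zs →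
    sum (tabulate λ j → lookup zs j * linkedSumAfter m (z ∷ zs) (suc j)) ≈ linkedSum (suc m) zs
  linkedSum-tail m z zs = C.trans
    (sum-tabulate-cong λ j → C.*-congˡ (linkedSumAfter-suc m z zs j))
    (C.sym (linkedSum-suc m zs))

  linkedSum-∷ : ∀ m z zs →
    linkedSum (suc m) (z ∷ zs) ≈ z * linkedSumAfter m (z ∷ zs) zero + linkedSum (suc m) zs
  linkedSum-∷ m z zs = C.trans (linkedSum-suc m (z ∷ zs)) (C.+-congˡ (linkedSum-tail m z zs))

-- The two booleans agree by computation only after a case split on the first index; for `<` they
-- agree at once, hence the bare `refl` in `Strict`.
suc≤?suc : ∀ {r} (i j : Fin r) → does (suc i Fin.≤? suc j) ≡ does (i Fin.≤? j)
suc≤?suc zero    _ = refl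
suc≤?suc (suc _) _ = refl

module Strict = LinkedSum {_≺_ = Fin._<_} Fin._<?_ (λ _ _ → refl) (λ _ → refl)
module Weak = LinkedSum {_≺_ = Fin._≤_} Fin._≤?_ suc≤?suc (λ _ → refl)

𝓔-zero : ∀ zs → 𝓔 zero zs ≈ 1ℂ
𝓔-zero = Strict.linkedSum-zero

𝓗-zero : ∀ zs → 𝓗 zero zs ≈ 1ℂ
𝓗-zero = Weak.linkedSum-zero

-- Strictly increasing tuples that start at the head cannot use it again, so they continue within
-- `zs`.
𝓔-∷ : ∀ m z zs → 𝓔 (suc m) (z ∷ zs) ≈ z * 𝓔 m zs + 𝓔 (suc m) zs
𝓔-∷ m z zs = C.trans (Strict.linkedSum-∷ m z zs) (C.+-congʳ (C.*-congˡ (after-zero m)))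
  where
  after-zero : ∀ m → Strict.linkedSumAfter m (z ∷ zs) zero ≈ 𝓔 m zs
  after-zero zero    = C.sym (𝓔-zero zs)
  after-zero (suc m) = C.trans (C.+-identityˡ _) (Strict.linkedSum-tail m z zs)

-- Weakly increasing tuples may repeat the head, and every index may follow it, so the continuation
-- ranges over the full list `z ∷ zs`.
𝓗-∷ : ∀ m z zs → 𝓗 (suc m) (z ∷ zs) ≈ z * 𝓗 m (z ∷ zs) + 𝓗 (suc m) zs
𝓗-∷ m z zs = C.trans (Weak.linkedSum-∷ m z zs) (C.+-congʳ (C.*-congˡ (after-zero m)))
  where
  after-zero : ∀ m → Weak.linkedSumAfter m (z ∷ zs) zero ≈ 𝓗 m (z ∷ zs)
  after-zero zero    = C.sym (𝓗-zero (z ∷ zs))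
  after-zero (suc m) = C.sym (Weak.linkedSum-suc m (z ∷ zs))

-- Formal power series, given by their coefficients

Series : Set
Series = ℕ → ℂ

infix 4 _≋_
_≋_ : Series → Series → Set
a ≋ b = ∀ m → a m ≈ b m

-- (1 − z t) a(t)
factor : ℂ → Series → Series
factor z a zero    = a zero
factor z a (suc m) = a (suc m) + - z * a m

factors : List ℂ → Series → Series
factors zs a = foldr factor a zs

-- The series 1; thus `factors zs δ` is the polynomial ∏ (1 - z t).
δ : Series
δ zero    = 1ℂ
δ (suc _) = 0ℂ

factor-cong : ∀ {z w a b} → z ≈ w → a ≋ b → factor z a ≋ factor w b
factor-cong z≈w a≋b zero    = a≋b zero
factor-cong z≈w a≋b (suc m) = C.+-cong (a≋b (suc m)) (C.*-cong (C.-‿cong z≈w) (a≋b m))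

factor-congˡ : ∀ z {a b} → a ≋ b → factor z a ≋ factor z b
factor-congˡ z = factor-cong (C.refl {z})

factor-comm : ∀ z w a → factor z (factor w a) ≋ factor w (factor z a)
factor-comm z w a zero          = C.refl
factor-comm z w a (suc zero)    =
  Solver.solve 4 (λ p q x y → (x :+ q :* y) :+ p :* y := (x :+ p :* y) :+ q :* y) C.refl
    (- z) (- w) (a 1) (a 0)
factor-comm z w a (suc (suc m)) =
  Solver.solve 5 (λ p q x y u → (x :+ q :* y) :+ p :* (y :+ q :* u) := (x :+ p :* y) :+ q :* (y :+ p :* u)) C.refl
    (- z) (- w) (a (suc (suc m))) (a (suc m)) (a m)

-- Since 1 - z t has constant term 1, the coefficients of the other factor are recovered one after
-- another.
factor-injective : ∀ z {a b} → factor z a ≋ factor z b → a ≋ b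
factor-injective z         e zero    = e zero
factor-injective z {a} {b} e (suc m) = ∙-cancelʳ (- z * a m) (a (suc m)) (b (suc m))
  (C.trans (e (suc m)) (C.+-congˡ (C.*-congˡ (C.sym (factor-injective z e m)))))

factors-cong : ∀ zs {a b} → a ≋ b → factors zs a ≋ factors zs b
factors-cong []       e = e
factors-cong (z ∷ zs) e = factor-congˡ z (factors-cong zs e)

factors-factor : ∀ zs w a → factors zs (factor w a) ≋ factor w (factors zs a)
factors-factor []       w a m = C.refl
factors-factor (z ∷ zs) w a m =
  C.trans (factor-congˡ z (factors-factor zs w a) m) (factor-comm z w (factors zs a) m)

factors-injective : ∀ zs {a b} → factors zs a ≋ factors zs b → a ≋ b
factors-injective []       e = e
factors-injective (z ∷ zs) e = factors-injective zs (factor-injective z e)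

-- Each linear factor raises the degree by at most one.
factors-degree : ∀ zs m → length zs ℕ.< m → factors zs δ m ≈ 0ℂ
factors-degree []       (suc m) _           = C.refl
factors-degree (z ∷ zs) (suc m) (ℕ.s≤s r<m) = begin
  factors zs δ (suc m) + - z * factors zs δ m
    ≈⟨ C.+-cong (factors-degree zs (suc m) (ℕ.m≤n⇒m≤1+n r<m)) (C.*-congˡ (factors-degree zs m r<m)) ⟩
  0ℂ + - z * 0ℂ  ≈⟨ C.+-identityˡ _ ⟩
  - z * 0ℂ       ≈⟨ C.zeroʳ (- z) ⟩
  0ℂ             ∎

-- Generating series of `𝓔` and `𝓗`.

factors-zero : ∀ zs a → factors zs a zero ≈ a zero
factors-zero []       a = C.refl
factors-zero (z ∷ zs) a = factors-zero zs a

-- This is Vieta's expansion of ∏ (1 - z t): once the sign is included, the recursion `𝓔-∷` is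
-- multiplication by 1 - z t.
signed-𝓔 : ∀ zs m → (- 1ℂ) ^ m * 𝓔 m zs ≈ factors zs δ m
signed-𝓔 zs       zero    = C.trans (C.*-identityˡ _) (C.trans (𝓔-zero zs) (C.sym (factors-zero zs δ)))
-- `𝓔 (suc m) []` computes to `0ℂ`, as there are no tuples to sum over.
signed-𝓔 []       (suc m) = C.zeroʳ _
signed-𝓔 (z ∷ zs) (suc m) = begin
  - 1ℂ * s * 𝓔 (suc m) (z ∷ zs)
    ≈⟨ C.*-congˡ (𝓔-∷ m z zs) ⟩
  - 1ℂ * s * (z * 𝓔 m zs + 𝓔 (suc m) zs)
    ≈⟨ Solver.solve 5 (λ n s z e e′ → n :* s :* (z :* e :+ e′) := n :* s :* e′ :+ n :* z :* (s :* e)) C.refl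
         (- 1ℂ) s z (𝓔 m zs) (𝓔 (suc m) zs) ⟩
  - 1ℂ * s * 𝓔 (suc m) zs + - 1ℂ * z * (s * 𝓔 m zs)
    ≈⟨ C.+-cong (signed-𝓔 zs (suc m)) (C.*-cong (-1*x≈-x z) (signed-𝓔 zs m)) ⟩
  factors zs δ (suc m) + - z * factors zs δ m ∎
  where s = (- 1ℂ) ^ m

-- Read on generating series, `𝓗-∷` says that h(z ∷ zs) = z t h(z ∷ zs) + h(zs).
factor-𝓗 : ∀ z zs → factor z (λ m → 𝓗 m (z ∷ zs)) ≋ λ m → 𝓗 m zs
factor-𝓗 z zs zero    = C.trans (𝓗-zero (z ∷ zs)) (C.sym (𝓗-zero zs))
factor-𝓗 z zs (suc m) = begin
  𝓗 (suc m) (z ∷ zs) + - z * h       ≈⟨ C.+-congʳ (𝓗-∷ m z zs) ⟩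
  (z * h + 𝓗 (suc m) zs) + - z * h
    ≈⟨ Solver.solve 4 (λ z y h h′ → (z :* h :+ h′) :+ y :* h := (z :+ y) :* h :+ h′) C.refl z (- z) h (𝓗 (suc m) zs) ⟩
  (z + - z) * h + 𝓗 (suc m) zs       ≈⟨ C.+-congʳ (C.*-congʳ (C.-‿inverseʳ z)) ⟩
  0ℂ * h + 𝓗 (suc m) zs              ≈⟨ C.+-congʳ (C.zeroˡ h) ⟩
  0ℂ + 𝓗 (suc m) zs                  ≈⟨ C.+-identityˡ _ ⟩
  𝓗 (suc m) zs                       ∎
  where h = 𝓗 m (z ∷ zs)

-- This is ∑ 𝓗ₘ tᵐ = 1 / ∏ (1 - z t) without the division. The factor of the head is moved inside,
-- where `factor-𝓗` removes the head from the list.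
factors-𝓗 : ∀ zs → factors zs (λ m → 𝓗 m zs) ≋ δ
factors-𝓗 []       zero    = 𝓗-zero []
factors-𝓗 []       (suc m) = C.refl
factors-𝓗 (z ∷ zs) m       = begin
  factor z (factors zs (λ k → 𝓗 k (z ∷ zs))) m  ≈⟨ factors-factor zs z _ m ⟨
  factors zs (factor z (λ k → 𝓗 k (z ∷ zs))) m  ≈⟨ factors-cong zs (factor-𝓗 z zs) m ⟩
  factors zs (λ k → 𝓗 k zs) m                   ≈⟨ factors-𝓗 zs m ⟩
  δ m                                            ∎

-- tⁿ a(t)
shift : ℕ → Series → Series
shift zero    a m       = a m
shift (suc n) a zero    = 0ℂ
shift (suc n) a (suc m) = shift n a m

-- (1 − tⁿ) a(t)
periodFactor : ℕ → Series → Series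
periodFactor n a m = a m + - shift n a m

shift-cong : ∀ n {a b} → a ≋ b → shift n a ≋ shift n b
shift-cong zero    e m       = e m
shift-cong (suc n) e zero    = C.refl
shift-cong (suc n) e (suc m) = shift-cong n e m

shift-below : ∀ {n m} a → m ℕ.< n → shift n a m ≈ 0ℂ
shift-below {suc n} {zero}  a _           = C.refl
shift-below {suc n} {suc m} a (ℕ.s≤s m<n) = shift-below a m<n

shift-+ : ∀ n a m → shift n a (n ℕ.+ m) ≡ a m
shift-+ zero    a m = refl
shift-+ (suc n) a m = shift-+ n a m

periodFactor-cong : ∀ n {a b} → a ≋ b → periodFactor n a ≋ periodFactor n b
periodFactor-cong n e m = C.+-cong (e m) (C.-‿cong (shift-cong n e m))

periodFactor-below : ∀ {n m} a → m ℕ.< n → periodFactor n a m ≈ a m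
periodFactor-below {n} {m} a m<n = begin
  a m + - shift n a m  ≈⟨ C.+-congˡ (C.-‿cong (shift-below a m<n)) ⟩
  a m + - 0ℂ           ≈⟨ C.+-congˡ ε⁻¹≈ε ⟩
  a m + 0ℂ             ≈⟨ C.+-identityʳ (a m) ⟩
  a m                  ∎

factor-shift : ∀ n z a → factor z (shift n a) ≋ shift n (factor z a)
factor-shift zero    z a zero          = C.refl
factor-shift zero    z a (suc m)       = C.refl
factor-shift (suc n) z a zero          = C.refl
-- Here `factor` meets the `0ℂ` that `shift` inserts in degree 0, while on the right degree 0 has no
-- second summand.
factor-shift (suc n) z a (suc zero)    = begin
  shift n a zero + - z * 0ℂ  ≈⟨ C.+-congˡ (C.zeroʳ (- z)) ⟩
  shift n a zero + 0ℂ        ≈⟨ C.+-identityʳ _ ⟩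
  shift n a zero             ≈⟨ factor-shift n z a zero ⟩
  shift n (factor z a) zero  ∎
factor-shift (suc n) z a (suc (suc m)) = factor-shift n z a (suc m)

factor-periodFactor : ∀ n z a → factor z (periodFactor n a) ≋ periodFactor n (factor z a)
factor-periodFactor n z a m = C.trans (linear m) (C.+-congˡ (C.-‿cong (factor-shift n z a m)))
  where
  linear : ∀ m → factor z (periodFactor n a) m ≈ factor z a m + - factor z (shift n a) m
  linear zero    = C.refl
  linear (suc m) = begin
    (x + - x′) + - z * (y + - y′)
      -- The negated coefficients enter as independent variables; their signs are collected in the
      -- next two steps.
      ≈⟨ Solver.solve 5 (λ x u w y v → (x :+ u) :+ w :* (y :+ v) := (x :+ w :* y) :+ (u :+ w :* v)) C.refl
           x (- x′) (- z) y (- y′) ⟩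
    (x + - z * y) + (- x′ + - z * - y′)
      ≈⟨ C.+-congˡ (C.+-congˡ (C.sym (-‿distribʳ-* (- z) y′))) ⟩
    (x + - z * y) + (- x′ + - (- z * y′))
      ≈⟨ C.+-congˡ (⁻¹-∙-comm x′ (- z * y′)) ⟩
    (x + - z * y) + - (x′ + - z * y′) ∎
    where
    x = a (suc m)
    y = a m
    x′ = shift n a (suc m)
    y′ = shift n a m

factors-periodFactor : ∀ n zs a → factors zs (periodFactor n a) ≋ periodFactor n (factors zs a)
factors-periodFactor n []       a m = C.refl
factors-periodFactor n (z ∷ zs) a m = C.trans
  (factor-congˡ z (factors-periodFactor n zs a) m) (factor-periodFactor n z (factors zs a) m)

-- Scaling every entry by `w` amounts to the substitution t ↦ w t.
factors-homogeneous : ∀ w zs m → factors (map (w *_) zs) δ m ≈ w ^ m * factors zs δ m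
factors-homogeneous w []       zero    = C.sym (C.*-identityˡ 1ℂ)
factors-homogeneous w []       (suc m) = C.sym (C.zeroʳ _)
factors-homogeneous w (z ∷ zs) zero    = factors-homogeneous w zs zero
factors-homogeneous w (z ∷ zs) (suc m) = begin
  factors (map (w *_) zs) δ (suc m) + - (w * z) * factors (map (w *_) zs) δ m
    ≈⟨ C.+-cong (factors-homogeneous w zs (suc m))
         (C.*-cong (-‿distribʳ-* w z) (factors-homogeneous w zs m)) ⟩
  w * w ^ m * x + w * - z * (w ^ m * y)
    ≈⟨ Solver.solve 5 (λ w v x u y → w :* v :* x :+ w :* u :* (v :* y) := w :* v :* (x :+ u :* y)) C.refl
         w (w ^ m) x (- z) y ⟩
  w * w ^ m * (x + - z * y) ∎
  where
  x = factors zs δ (suc m)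
  y = factors zs δ m

-- `applyUpTo` exposes the first factor; the last one comes out by commuting it past the others.
factors-applyUpTo-suc : ∀ g n a →
  factors (applyUpTo g (suc n)) a ≋ factor (g n) (factors (applyUpTo g n) a)
factors-applyUpTo-suc g zero    a m = C.refl
factors-applyUpTo-suc g (suc n) a m = C.trans
  (factor-congˡ (g 0) (factors-applyUpTo-suc (g ∘ suc) n a) m)
  (factor-comm (g 0) (g (suc n)) (factors (applyUpTo (g ∘ suc) n) a) m)

-- Each index contributes its factor to exactly one of the two products; a factor of the complement
-- is first commuted past those of `J`.
factors-complement : ∀ {n} (f : Fin n → ℂ) (J : Subset n) is a →
  factors (map f (filter (_∈? J) is)) (factors (map f (filter (_∈? ∁ J) is)) a) ≋ factors (map f is) a
factors-complement f J []       a m = C.refl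
factors-complement f J (i ∷ is) a m with i ∈? J | i ∈? ∁ J
... | yes i∈J | yes i∈∁J = contradiction i∈∁J (x∈p⇒x∉∁p i∈J)
... | yes i∈J | no  _    = factor-congˡ (f i) (factors-complement f J is a) m
... | no  i∉J | yes _    = C.trans (factors-factor (map f (filter (_∈? J) is)) (f i) _ m)
                             (factor-congˡ (f i) (factors-complement f J is a) m)
... | no  i∉J | no i∉∁J  = contradiction (x∉p⇒x∈∁p i∉J) i∉∁J


shift-δ : ∀ n → shift n δ n ≈ 1ℂ
shift-δ zero    = C.refl
shift-δ (suc n) = shift-δ n

shift-δ-above : ∀ {n m} → n ℕ.< m → shift n δ m ≈ 0ℂ
shift-δ-above {zero}  {suc m} _           = C.refl
shift-δ-above {suc n} {suc m} (ℕ.s≤s n<m) = shift-δ-above n<m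

-- Roots of unity

module _ {n ζ} (prim : PrimitiveRoot (suc n) ζ) where
  open PrimitiveRoot prim

  private
    roots nontrivial : List ℂ
    roots      = applyUpTo (ζ ^_) (suc n)
    nontrivial = applyUpTo (λ i → ζ ^ suc i) n

    -- As `ζ ^ 0` computes to `1ℂ`, `c` is `factor 1ℂ q` by definition. The order is `suc n`, so `n`
    -- counts the other roots.
    c q : Series
    c = factors roots δ
    q = factors nontrivial δ

    -- Multiplication by ζ permutes the roots.
    rotate : ∀ m → ζ ^ m * c m ≈ c m
    rotate m = begin
      ζ ^ m * c m                      ≈⟨ factors-homogeneous ζ roots m ⟨
      factors (map (ζ *_) roots) δ m   ≡⟨ cong (λ zs → factors zs δ m) (map-applyUpTo (ζ ^_) (ζ *_) (suc n)) ⟩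
      factors rotated δ m              ≈⟨ factor-injective 1ℂ cyclic m ⟩
      c m                              ∎
      where
      rotated : List ℂ
      rotated = applyUpTo (λ i → ζ ^ suc i) (suc n)

      -- With 1 put in front, the rotated list becomes the powers with exponents 0 to `suc n`; the
      -- last of them is again 1 by `isRoot`.
      cyclic : factor 1ℂ (factors rotated δ) ≋ factor 1ℂ c
      cyclic k = C.trans (factors-applyUpTo-suc (ζ ^_) (suc n) δ k) (factor-cong isRoot (λ _ → C.refl) k)

    c₀ : c 0 ≈ 1ℂ
    c₀ = factors-zero roots δ

    c-middle : ∀ {m} → 0 ℕ.< m → m ℕ.≤ n → c m ≈ 0ℂ
    c-middle {m} 0<m m≤n = ℂ-zero-product product≈0 λ e → notBefore m 0<m (ℕ.s≤s m≤n) (x∙y⁻¹≈ε⇒x≈y _ _ e)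
      where
      product≈0 : (ζ ^ m + - 1ℂ) * c m ≈ 0ℂ
      product≈0 = begin
        (ζ ^ m + - 1ℂ) * c m        ≈⟨ C.distribʳ (c m) (ζ ^ m) (- 1ℂ) ⟩
        ζ ^ m * c m + - 1ℂ * c m    ≈⟨ C.+-cong (rotate m) (-1*x≈-x (c m)) ⟩
        c m + - c m                 ≈⟨ C.-‿inverseʳ (c m) ⟩
        0ℂ                          ∎

    -- Since 1 is a root, c = (1 − t) q with q of degree n − 1.
    q≈1 : ∀ m → m ℕ.≤ n → q m ≈ 1ℂ
    q≈1 zero    _   = c₀
    q≈1 (suc m) m<n = C.trans
      -- The vanishing coefficient `c (suc m)` is the difference of two consecutive coefficients of
      -- `q`, so these are equal.
      (x∙y⁻¹≈ε⇒x≈y _ _ (C.trans (C.+-congˡ (C.sym (-1*x≈-x (q m)))) (c-middle ℕ.z<s m<n)))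
      (q≈1 m (ℕ.<⇒≤ m<n))

    c-top : c (suc n) ≈ - 1ℂ
    c-top = begin
      q (suc n) + - 1ℂ * q n  ≈⟨ C.+-cong (factors-degree nontrivial (suc n) length<) (C.*-congˡ (q≈1 n ℕ.≤-refl)) ⟩
      0ℂ + - 1ℂ * 1ℂ          ≈⟨ C.+-identityˡ _ ⟩
      - 1ℂ * 1ℂ               ≈⟨ C.*-identityʳ (- 1ℂ) ⟩
      - 1ℂ                    ∎
      where
      length< : length nontrivial ℕ.< suc n
      length< = ℕ.s≤s (ℕ.≤-reflexive (length-applyUpTo (λ i → ζ ^ suc i) n))

  -- The coefficients are compared below, at and above degree `suc n`: `c₀` and `c-middle`, then
  -- `c-top`, then the degree bound.
  factors-roots : factors (applyUpTo (ζ ^_) (suc n)) δ ≋ periodFactor (suc n) δ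
  factors-roots m with ℕ.<-cmp m (suc n)
  ... | tri< m<n _ _ = C.trans (below m m<n) (C.sym (periodFactor-below δ m<n))
    where
    below : ∀ m → m ℕ.< suc n → c m ≈ δ m
    below zero    _           = c₀
    below (suc m) (ℕ.s≤s m<n) = c-middle ℕ.z<s m<n
  ... | tri≈ _ refl _ = begin
    c (suc n)                ≈⟨ c-top ⟩
    - 1ℂ                     ≈⟨ C.-‿cong (shift-δ n) ⟨
    - shift n δ n            ≈⟨ C.+-identityˡ _ ⟨
    0ℂ + - shift n δ n       ∎
  factors-roots (suc m) | tri> _ _ (ℕ.s≤s n<m) = begin
    c (suc m)                ≈⟨ factors-degree roots (suc m) length< ⟩
    0ℂ                       ≈⟨ ε⁻¹≈ε ⟨
    - 0ℂ                     ≈⟨ C.-‿cong (shift-δ-above n<m) ⟨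
    - shift n δ m            ≈⟨ C.+-identityˡ _ ⟨
    0ℂ + - shift n δ m       ∎
    where
    length< : length roots ℕ.< suc m
    length< = ℕ.s≤s (ℕ.≤-trans (ℕ.≤-reflexive (length-applyUpTo (λ i → ζ ^ i) (suc n))) n<m)

-- Complementary sets of roots and periodicity of `𝓗`.

tabulate-toℕ : ∀ (g : ℕ → A) n → tabulate {n = n} (g ∘ toℕ) ≡ applyUpTo g n
tabulate-toℕ g zero    = refl
tabulate-toℕ g (suc n) = cong (g 0 ∷_) (tabulate-toℕ (g ∘ suc) n)

module _ {n ζ} .{{_ : NonZero n}} (prim : PrimitiveRoot n ζ) (J : Subset n) where

  private
    h c : Series
    h m = 𝓗 m (powers ζ J)
    c   = factors (powers ζ (∁ J)) δ

    -- The order is quantified anew so that it can be matched with `suc n`, the form in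
    -- `factors-roots`.
    all-roots : ∀ {n} → PrimitiveRoot n ζ → .{{NonZero n}} →
      factors (map (λ i → ζ ^ toℕ i) (allFin n)) δ ≋ periodFactor n δ
    all-roots {suc n} prim m = C.trans
      (C.reflexive (cong (λ zs → factors zs δ m)
        (trans (map-tabulate id (λ i → ζ ^ toℕ i)) (tabulate-toℕ (ζ ^_) (suc n)))))
      (factors-roots prim m)

  -- The factors over `J` are cancelled from both sides: they complete `c` to the product over all
  -- roots, and they turn `h` into 1.
  factors-∁≋periodFactor-𝓗 : c ≋ periodFactor n h
  factors-∁≋periodFactor-𝓗 = factors-injective (powers ζ J) λ m → begin
    factors (powers ζ J) c m                                 ≈⟨ factors-complement _ J (allFin n) δ m ⟩
    factors (map (λ i → ζ ^ toℕ i) (allFin n)) δ m           ≈⟨ all-roots prim m ⟩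
    periodFactor n δ m                                       ≈⟨ periodFactor-cong n (factors-𝓗 (powers ζ J)) m ⟨
    periodFactor n (factors (powers ζ J) h) m                ≈⟨ factors-periodFactor n (powers ζ J) h m ⟨
    factors (powers ζ J) (periodFactor n h) m                ∎

  -- An element of `J` is dropped when `allFin n` is filtered by `∁ J`. This puts the degree of `c`
  -- below `n`.
  length-∁ : Nonempty J → length (powers ζ (∁ J)) ℕ.< n
  length-∁ (i , i∈J) = subst₂ ℕ._<_ (sym (length-map _ (filter (_∈? ∁ J) (allFin n)))) (length-tabulate {n = n} id)
    (filter-notAll (_∈? ∁ J) (allFin n) (Any.map (λ { refl → x∈p⇒x∉∁p i∈J }) (∈-allFin i)))

  -- In degree `n + m` the polynomial `c` vanishes, so the corresponding coefficient of (1 - tⁿ) h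
  -- does too.
  𝓗-period : Nonempty J → ∀ m → h (n ℕ.+ m) ≈ h m
  𝓗-period J≢∅ m = C.trans (x∙y⁻¹≈ε⇒x≈y _ _ (begin
    h (n ℕ.+ m) + - shift n h (n ℕ.+ m)   ≈⟨ factors-∁≋periodFactor-𝓗 (n ℕ.+ m) ⟨
    c (n ℕ.+ m)                           ≈⟨ factors-degree (powers ζ (∁ J)) (n ℕ.+ m) (ℕ.<-≤-trans (length-∁ J≢∅) (ℕ.m≤m+n n m)) ⟩
    0ℂ                                    ∎))
    (C.reflexive (shift-+ n h m))

  𝓗-remainder : Nonempty J → ∀ m → h m ≈ h (m % n)
  -- The remainder is moved to the end so that each copy of `n` stands in front, as `𝓗-period`
  -- expects.
  𝓗-remainder J≢∅ m = C.trans (C.reflexive (cong h (trans (m≡m%n+[m/n]*n m n) (ℕ.+-comm (m % n) _)))) (periods (m / n))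
    where
    periods : ∀ k → h (k ℕ.* n ℕ.+ m % n) ≈ h (m % n)
    periods zero    = C.refl
    periods (suc k) = C.trans (C.reflexive (cong h (ℕ.+-assoc n (k ℕ.* n) (m % n))))
      (C.trans (𝓗-period J≢∅ (k ℕ.* n ℕ.+ m % n)) (periods k))

theorem1p1 : ∀ (n m : ℕ) .{{_ : NonZero n}} (ζ : ℂ) → PrimitiveRoot n ζ →
    (J : Subset n) → Nonempty J →
    𝓗 m (powers ζ J) ≈ (- 1ℂ) ^ (m % n) * 𝓔 (m % n) (powers ζ (∁ J))
theorem1p1 n m ζ prim J J≢∅ = begin
  𝓗 m (powers ζ J)                                   ≈⟨ 𝓗-remainder prim J J≢∅ m ⟩
  -- As `m % n` is below `n`, multiplication by 1 - tⁿ leaves this coefficient unchanged.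
  𝓗 (m % n) (powers ζ J)                             ≈⟨ periodFactor-below (λ k → 𝓗 k (powers ζ J)) (m%n<n m n) ⟨
  periodFactor n (λ k → 𝓗 k (powers ζ J)) (m % n)    ≈⟨ factors-∁≋periodFactor-𝓗 prim J (m % n) ⟨
  factors (powers ζ (∁ J)) δ (m % n)                 ≈⟨ signed-𝓔 (powers ζ (∁ J)) (m % n) ⟨
  (- 1ℂ) ^ (m % n) * 𝓔 (m % n) (powers ζ (∁ J))      ∎
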